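{- For every integer $t \geq 2$ there exists an integer $M = M(t)$ such that every graph with no odd $K_t$ minor is $(10t-13)$-colorable with clustering $M$. In other words, the clustered chromatic number of the class of graphs with no odd $K_t$ minor is at most $10t-13$.
   Context: All graphs are finite and simple. A graph $G$ is $k$-colorable with clustering $M$ if there is a map $\alpha: V(G)\to\{1,\dots,k\}$ such that each color class $\alpha^{ -1}(\{i\})$ induces a subgraph with no connected component having more than $M$ vertices. The clustered chromatic number of a class $\mathcal C$ of graphs is the minimum $k$ such that for some $M$ all graphs in $\mathcal C$ are $k$-colorable with clustering $M$. A graph $G$ contains $H$ as an odd minor if there exist vertex-disjoint subgraphs $\{T_u\}_{u\in V(H)}$ of $G$ which are trees, and a coloring $\alpha:\bigcup_{u\in V(H)}V(T_u)\to\{1,2\}$ such that for every $u\in V(H)$ every edge of $T_u$ has ends of different colors, and for every edge $vw\in E(H)$ there is an edge of $G$ joining $V(T_v)$ and $V(T_w)$ whose two ends have the same color. "No odd $K_t$ minor" means $G$ does not contain the complete graph $K_t$ as an odd minor. -}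

module Defs where

open import Data.Nat using (ℕ; _≤_)
open import Data.Fin using (Fin)
open import Data.Bool using (Bool; true; false)
open import Data.Maybe using (Maybe; just)
open import Data.List using (List; []; _∷_; _++_; [_]; length)
open import Data.List.Relation.Unary.All using (All)
open import Data.List.Relation.Unary.Linked using (Linked)
open import Data.List.Relation.Unary.Unique.Propositional using (Unique)
open import Data.Product using (Σ; ∃; ∃-syntax; _×_)
open import Relation.Binary.PropositionalEquality using (_≡_; _≢_)
open import Relation.Nullary using (¬_)

record Graph : Set where
  field
    n      : ℕ
    adj    : Fin n → Fin n → Bool
    sym    : ∀ x y → adj x y ≡ adj y x
    irrefl : ∀ x → adj x x ≡ false
open Graph public

data Walk {A : Set} (R : A → A → Set) : A → A → Set where
  here : ∀ {x} → Walk R x x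
  step : ∀ {x y z} → R x y → Walk R y z → Walk R x z

HasCycle : {A : Set} → (A → A → Set) → Set
HasCycle {A} R = Σ A λ x₀ → Σ (List A) λ ys →
  Unique (x₀ ∷ ys) × (2 ≤ length ys) × Linked R (x₀ ∷ ys ++ [ x₀ ])

MonoEdge : (G : Graph) {k : ℕ} → (Fin (n G) → Fin k) → Fin (n G) → Fin (n G) → Set
MonoEdge G α x y = (adj G x y ≡ true) × (α x ≡ α y)

-- α is a colouring with clustering M: every connected component of every
-- colour class has at most M vertices, i.e. every duplicate-free list of
-- vertices in the monochromatic component of any vertex v has length ≤ M.
HasClustering : (G : Graph) {k : ℕ} → (Fin (n G) → Fin k) → ℕ → Set
HasClustering G α M = ∀ (v : Fin (n G)) (xs : List (Fin (n G))) →
  Unique xs → All (λ y → Walk (MonoEdge G α) v y) xs → length xs ≤ M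

ClusteredColorable : Graph → ℕ → ℕ → Set
ClusteredColorable G k M = Σ (Fin (n G) → Fin k) λ α → HasClustering G α M

-- A model of K_t as an odd minor in G:
--  * branch : vertex x belongs to tree T_u iff branch x ≡ just u
--    (so the trees are automatically vertex-disjoint);
--  * tedge  : which edges of G are edges of the trees (symmetric, a subset
--    of E(G)); the edges of T_u are the selected edges with both ends in T_u;
--  * col    : the 2-colouring α.
record OddKMinor (G : Graph) (t : ℕ) : Set where
  field
    branch : Fin (n G) → Maybe (Fin t)
    tedge  : Fin (n G) → Fin (n G) → Bool
    col    : Fin (n G) → Bool
    tedge-sym : ∀ x y → tedge x y ≡ tedge y x
    tedge-adj : ∀ x y → tedge x y ≡ true → adj G x y ≡ true

  TEdge : Fin t → Fin (n G) → Fin (n G) → Set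
  TEdge u x y = (branch x ≡ just u) × (branch y ≡ just u) × (tedge x y ≡ true)

  field
    nonempty  : ∀ u → ∃[ x ] branch x ≡ just u
    connected : ∀ u x y → branch x ≡ just u → branch y ≡ just u →
                Walk (TEdge u) x y
    acyclic   : ∀ u → ¬ HasCycle (TEdge u)
    bichromatic : ∀ u x y → TEdge u x y → col x ≢ col y
    realised : ∀ u v → u ≢ v → ∃[ x ] ∃[ y ]
      (branch x ≡ just u) × (branch y ≡ just v) ×
      (adj G x y ≡ true) × (col x ≡ col y)

HasOddKMinor : Graph → ℕ → Set
HasOddKMinor G t = OddKMinor G t

-- In fact 2t colours and clustering t suffice. Cut the graph recursively into pieces, each spanned by
-- a rooted tree and 2-coloured by the parity of the tree depth. Let K be a component of what is left,
-- and suppose that the pieces touching K are pairwise joined by monochromatic edges and that every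
-- vertex of K adjacent to one of them has neighbours of both colours in it. Fix a root in K and take a
-- shortest path in K from it to each of these pieces. The union of the paths has at most t vertices on
-- each level, so it is 2-coloured by parity with clustering t. Now keep adding vertices of K whose
-- neighbours in the new piece all have one colour: each gets the other colour and creates no
-- monochromatic edge. When no such vertex is left, every remaining vertex of K adjacent to the new
-- piece sees both its colours, so the invariant is restored, and the new piece is joined to the old ones
-- by monochromatic edges. As there is no odd K_t minor, fewer than t pieces touch any K, so one of t
-- pairs of colours is always free for the new piece.

module Submission where

open import Defs
open import Data.Nat using (ℕ; zero; suc; _+_; _≤_; _<_; _*_; _∸_; z≤n; s≤s)
open import Data.Nat.Properties using (module ≤-Reasoning; ≤-refl; ≤-trans; ≤-reflexive; <-irrefl; <-trans; ≤∧≢⇒<; m≤n⇒m≤1+n; m+n≤o⇒m≤o∸n; m≤m+n; m+n∸n≡m; <⇒≤; suc-injective; +-suc; +-identityʳ)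
import Data.Nat.Properties as ℕ
open import Data.Nat.Tactic.RingSolver using (solve-∀)
open import Data.Nat.Induction using (<-wellFounded)
open import Induction.WellFounded using (Acc; acc)
open import Data.Fin using (Fin; combine; inject≤)
import Data.Fin as Fin
import Data.Fin.Properties as Fin
open import Data.Bool using (Bool; true; false; not; if_then_else_)
import Data.Bool.Properties as Bool
open import Data.Maybe using (Maybe; just; nothing; maybe)
open import Data.Empty using (⊥)
open import Data.Sum using (_⊎_; inj₁; inj₂; [_,_]′)
import Data.Sum as Sum
open import Data.Product using (∃; ∃-syntax; _×_; _,_; proj₁; proj₂)
open import Data.List using (List; []; _∷_; _++_; [_]; length; map; filter; allFin; lookup; concatMap; applyUpTo)
open import Data.List.Properties using (length-map; length-filter; filter-notAll; length-tabulate)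
open import Data.List.Membership.Propositional using (_∈_; _∉_; find; lose)
open import Data.List.Membership.Propositional.Properties using (∈-filter⁺; ∈-filter⁻; ∈-allFin; ∈-map⁺; ∈-lookup; ∈-++⁺ˡ; ∈-++⁺ʳ; ∈-++⁻; ∈-concatMap⁺; ∈-concatMap⁻; ∈-applyUpTo⁺; ∈-applyUpTo⁻)
open import Data.List.Relation.Unary.Any as Any using (Any; here; there)
open import Data.List.Relation.Unary.Any.Properties using (lookup-index)
open import Data.List.Relation.Unary.All as All using (All; []; _∷_)
import Data.List.Relation.Unary.All.Properties as All
open import Data.List.Relation.Unary.AllPairs using (AllPairs; []; _∷_)
import Data.List.Relation.Unary.AllPairs.Properties as AllPairs
open import Data.List.Relation.Unary.Linked as Linked using (Linked; []; _∷_)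
open import Data.List.Relation.Unary.Unique.Propositional using (Unique)
open import Data.List.Relation.Unary.Unique.Propositional.Properties using (allFin⁺)
open import Data.List.Relation.Binary.Permutation.Propositional.Properties using (∷↭∷ʳ)
open import Data.List.Relation.Binary.Permutation.Propositional using (↭⇒↭ₛ)
import Data.List.Relation.Binary.Permutation.Setoid.Properties as Permutation
open import Function using (_∘_; mk⇔)
open import Relation.Binary using (Symmetric)
open import Relation.Binary.PropositionalEquality using (_≡_; _≢_; refl; trans; cong; subst; setoid) renaming (sym to ≡-sym)
open import Relation.Unary using (Decidable)
open import Relation.Nullary using (¬_; Dec; yes; no; does; contradiction)
open import Relation.Nullary.Decidable using (_×-dec_; _⊎-dec_; _→-dec_; ¬?; does-⇔; dec-true; decidable-stable; map′)

-- Parity, walks, lists of vertices and saturation.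

infix 4 _∈?_

_∈?_ : ∀ {m} (x : Fin m) (xs : List (Fin m)) → Dec (x ∈ xs)
x ∈? xs = Any.any? (x Fin.≟_) xs

even : ℕ → Bool
even zero    = true
even (suc k) = not (even k)

-- Applied to the ranks of adjacent vertices in a breadth-first search: an edge whose ends have
-- equal parity stays on one level.
even-close⇒≡ : ∀ {a b} → a ≤ suc b → b ≤ suc a → even a ≡ even b → a ≡ b
even-close⇒≡ {zero}        {zero}        _        _        _  = refl
even-close⇒≡ {zero}        {suc zero}    _        _        ()
even-close⇒≡ {zero}        {suc (suc _)} _        (s≤s ()) _
even-close⇒≡ {suc zero}    {zero}        _        _        ()
even-close⇒≡ {suc (suc _)} {zero}        (s≤s ()) _        _
even-close⇒≡ {suc a}       {suc b}       (s≤s p)  (s≤s q)  e  =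
  cong suc (even-close⇒≡ p q (Bool.not-injective e))

<⇒∃suc : ∀ {r j i} → r ≡ j + i → j < r → ∃[ k ] i ≡ suc k
<⇒∃suc {j = j} {zero}  r≡ j<r = contradiction j<r (ℕ.≤⇒≯ (≤-reflexive (trans r≡ (+-identityʳ j))))
<⇒∃suc         {i = suc k} _ _  = k , refl

walk-trans : ∀ {A : Set} {R : A → A → Set} {x y z} → Walk R x y → Walk R y z → Walk R x z
walk-trans here       w = w
walk-trans (step r v) w = step r (walk-trans v w)

walk-sym : ∀ {A : Set} {R : A → A → Set} → (∀ {x y} → R x y → R y x) →
  ∀ {x y} → Walk R x y → Walk R y x
walk-sym R-sym here       = here
walk-sym R-sym (step r w) = walk-trans (walk-sym R-sym w) (step (R-sym r) here)

walk-map : ∀ {A : Set} {R S : A → A → Set} → (∀ {x y} → R x y → S x y) →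
  ∀ {x y} → Walk R x y → Walk S x y
walk-map f here       = here
walk-map f (step r w) = step (f r) (walk-map f w)

allPairs-lookup : ∀ {A : Set} {R : A → A → Set} → Symmetric R → ∀ {xs} → AllPairs R xs →
  ∀ i j → i ≢ j → R (lookup xs i) (lookup xs j)
allPairs-lookup R-sym (_ ∷ _)     Fin.zero    Fin.zero    i≢j = contradiction refl i≢j
allPairs-lookup R-sym (rs ∷ _)    Fin.zero    (Fin.suc j) _   = All.lookup rs (∈-lookup j)
allPairs-lookup R-sym (rs ∷ _)    (Fin.suc i) Fin.zero    _   = R-sym (All.lookup rs (∈-lookup i))
allPairs-lookup R-sym (_ ∷ pairs) (Fin.suc i) (Fin.suc j) i≢j =
  allPairs-lookup R-sym pairs i j (i≢j ∘ cong Fin.suc)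

-- Pigeonhole: sending each index of `xs` to a position of the same entry in `ys` is injective, as
-- `xs` has no repetitions.
unique⊆⇒length≤ : ∀ {A : Set} {xs ys : List A} → Unique xs → All (_∈ ys) xs → length xs ≤ length ys
unique⊆⇒length≤ {xs = xs} {ys} uniq sub = Fin.injective⇒≤ {f = position} position-injective
  where
  position : Fin (length xs) → Fin (length ys)
  position i = Any.index (All.lookup sub (∈-lookup i))

  lookup-position : ∀ i → lookup xs i ≡ lookup ys (position i)
  lookup-position i = lookup-index (All.lookup sub (∈-lookup i))

  position-injective : ∀ {i j} → position i ≡ position j → i ≡ j
  position-injective {i} {j} e = decidable-stable (i Fin.≟ j) λ i≢j →
    allPairs-lookup (_∘ ≡-sym) uniq i j i≢j
      (trans (lookup-position i) (trans (cong (lookup ys) e) (≡-sym (lookup-position j))))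

fresh : ∀ {m} (xs : List (Fin m)) → length xs < m → ∃[ x ] x ∉ xs
fresh {m} xs short with Fin.any? (λ x → ¬? (x ∈? xs))
... | yes found = found
... | no none = contradiction short (ℕ.≤⇒≯ (begin
  m                  ≡⟨ length-tabulate {n = m} (λ i → i) ⟨
  length (allFin m)  ≤⟨ unique⊆⇒length≤ (allFin⁺ m) (All.tabulate λ {x} _ →
                          decidable-stable (x ∈? xs) λ x∉ → none (x , x∉)) ⟩
  length xs          ∎))
  where
  open ≤-Reasoning

-- Serves to pick one vertex of a component for each piece touching it; taking exactly one witness
-- per entry keeps their number under control.
choose : ∀ {A B : Set} {P : B → Set} {R : A → B → Set} {as : List A} →
  All (λ a → ∃[ b ] P b × R a b) as →
  ∃[ bs ] length bs ≡ length as × All P bs × All (λ a → ∃[ b ] b ∈ bs × R a b) as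
choose []                  = [] , refl , [] , []
choose ((b , p , r) ∷ ops) =
  let bs , len , ps , rs = choose ops in
  b ∷ bs , cong suc len , p ∷ ps , (b , here refl , r) ∷ All.map (λ (c , c∈ , r′) → c , there c∈ , r′) rs

filter-mono-≤ : ∀ {A : Set} {P Q : A → Set} (P? : Decidable P) (Q? : Decidable Q) →
  (∀ {x} → P x → Q x) → ∀ xs → length (filter P? xs) ≤ length (filter Q? xs)
filter-mono-≤ P? Q? P⇒Q []       = z≤n
filter-mono-≤ P? Q? P⇒Q (x ∷ xs) with P? x | Q? x
... | yes _ | yes _ = s≤s (filter-mono-≤ P? Q? P⇒Q xs)
... | yes p | no ¬q = contradiction (P⇒Q p) ¬q
... | no _  | yes _ = m≤n⇒m≤1+n (filter-mono-≤ P? Q? P⇒Q xs)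
... | no _  | no _  = filter-mono-≤ P? Q? P⇒Q xs

filter-mono-< : ∀ {A : Set} {P Q : A → Set} (P? : Decidable P) (Q? : Decidable Q) →
  (∀ {x} → P x → Q x) → ∀ {x xs} → x ∈ xs → Q x → ¬ P x → length (filter P? xs) < length (filter Q? xs)
filter-mono-< P? Q? P⇒Q {x} {_ ∷ xs} (here refl) q ¬p with P? x | Q? x
... | yes p | _     = contradiction p ¬p
... | no _  | no ¬q = contradiction q ¬q
... | no _  | yes _ = s≤s (filter-mono-≤ P? Q? P⇒Q xs)
filter-mono-< P? Q? P⇒Q {xs = y ∷ _} (there x∈) q ¬p with P? y | Q? y
... | yes _  | yes _ = s≤s (filter-mono-< P? Q? P⇒Q x∈ q ¬p)
... | yes p′ | no ¬q = contradiction (P⇒Q p′) ¬q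
... | no _   | yes _ = m≤n⇒m≤1+n (filter-mono-< P? Q? P⇒Q x∈ q ¬p)
... | no _   | no _  = filter-mono-< P? Q? P⇒Q x∈ q ¬p

module _ {m : ℕ} {S : Set} (elements : S → List (Fin m)) where

  Grown : S → S → Set
  Grown s s′ = (∀ {x} → x ∈ elements s → x ∈ elements s′) × ∃[ x ] x ∈ elements s′ × x ∉ elements s

  -- Terminates because every `Grown` step lowers the number of missing vertices. Both the
  -- breadth-first search and the enlargement of a patch are run by it.
  saturate : ∀ {Done : S → Set} → (∀ s → Done s ⊎ ∃ (Grown s)) → S → ∃ Done
  saturate {Done} advance s = go s (<-wellFounded (missing s))
    where
    missing : S → ℕ
    missing s = length (filter (λ x → ¬? (x ∈? elements s)) (allFin m))

    go : ∀ s → Acc _<_ (missing s) → ∃ Done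
    go s (acc rec) with advance s
    ... | inj₁ done = s , done
    ... | inj₂ (s′ , s⊆s′ , x , x∈s′ , x∉s) = go s′ (rec
      (filter-mono-< (λ y → ¬? (y ∈? elements s′)) (λ y → ¬? (y ∈? elements s))
        (_∘ s⊆s′) (∈-allFin x) x∉s (λ x∉s′ → x∉s′ x∈s′)))

-- Rooted trees in a graph.

module InGraph (G : Graph) where

  V : Set
  V = Fin (n G)

  infix 4 _~_ _~?_

  _~_ : V → V → Set
  x ~ y = adj G x y ≡ true

  _~?_ : ∀ x y → Dec (x ~ y)
  x ~? y = adj G x y Bool.≟ true

  ~-sym : ∀ {x y} → x ~ y → y ~ x
  ~-sym {x} {y} = trans (Graph.sym G y x)

  -- Edges are not stored: they are recovered by choosing for each vertex of positive rank a
  -- neighbour one rank lower. Descending from `root` ends at rank zero, hence at `root` itself,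
  -- whose rank is therefore zero.
  record Tree : Set where
    field
      verts     : List V
      root      : V
      root∈     : root ∈ verts
      rank      : V → ℕ
      rank-zero : ∀ {x} → x ∈ verts → rank x ≡ 0 → x ≡ root
      above     : ∀ {x k} → x ∈ verts → rank x ≡ suc k → ∃[ y ] y ∈ verts × x ~ y × rank y ≡ k

    side : V → Bool
    side x = even (rank x)

    Above : V → V → Set
    Above x y = x ~ y × rank x ≡ suc (rank y)

    above? : ∀ x → Dec (Any (Above x) verts)
    above? x = Any.any? (λ y → (x ~? y) ×-dec (rank x ℕ.≟ suc (rank y))) verts

    parent : V → V
    parent x with above? x
    ... | yes p = proj₁ (find p)
    -- A default that creates no edge, since `Child` also demands a drop in rank.
    ... | no _  = x

    parent-spec : ∀ {x k} → x ∈ verts → rank x ≡ suc k →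
      parent x ∈ verts × x ~ parent x × rank x ≡ suc (rank (parent x))
    parent-spec {x} x∈ rx with above? x
    ... | yes p = proj₂ (find p)
    ... | no ¬p = let y , y∈ , x~y , ry = above x∈ rx in
      contradiction (lose y∈ (x~y , trans rx (cong suc (≡-sym ry)))) ¬p

    Child : V → V → Set
    Child x y = rank x ≡ suc (rank y) × parent x ≡ y

    child⇒~ : ∀ {x y} → x ∈ verts → Child x y → x ~ y
    child⇒~ x∈ (rx , refl) = proj₁ (proj₂ (parent-spec x∈ rx))

    child⇒side : ∀ {x y} → Child x y → side x ≢ side y
    child⇒side {x} {y} (rx , _) e = Bool.not-¬ {even (rank y)} refl (trans (≡-sym e) (cong even rx))

    child⇒< : ∀ {x y} → Child x y → rank y < rank x
    child⇒< (rx , _) = ≤-reflexive (≡-sym rx)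

    TreeEdge : V → V → Set
    TreeEdge x y = x ∈ verts × y ∈ verts × (Child x y ⊎ Child y x)

    treeEdge? : ∀ x y → Dec (TreeEdge x y)
    treeEdge? x y = (x ∈? verts) ×-dec (y ∈? verts) ×-dec (child? x y ⊎-dec child? y x)
      where
      child? : ∀ x y → Dec (Child x y)
      child? x y = (rank x ℕ.≟ suc (rank y)) ×-dec (parent x Fin.≟ y)

    treeEdge-sym : ∀ {x y} → TreeEdge x y → TreeEdge y x
    treeEdge-sym (x∈ , y∈ , c) = y∈ , x∈ , Sum.swap c

    treeEdge⇒~ : ∀ {x y} → TreeEdge x y → x ~ y
    treeEdge⇒~ (x∈ , _  , inj₁ c) = child⇒~ x∈ c
    treeEdge⇒~ (_  , y∈ , inj₂ c) = ~-sym (child⇒~ y∈ c)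

    treeEdge⇒side : ∀ {x y} → TreeEdge x y → side x ≢ side y
    treeEdge⇒side (_ , _ , inj₁ c) = child⇒side c
    treeEdge⇒side (_ , _ , inj₂ c) = child⇒side c ∘ ≡-sym

    to-root : ∀ {x} k → x ∈ verts → rank x ≡ k → Walk TreeEdge x root
    to-root zero    x∈ rx = subst (Walk TreeEdge _) (rank-zero x∈ rx) here
    to-root (suc k) x∈ rx =
      let p∈ , _ , rx′ = parent-spec x∈ rx in
      step (x∈ , p∈ , inj₁ (rx′ , refl)) (to-root k p∈ (suc-injective (trans (≡-sym rx′) rx)))

    tree-connected : ∀ {x y} → x ∈ verts → y ∈ verts → Walk TreeEdge x y
    tree-connected x∈ y∈ = walk-trans (to-root _ x∈ refl) (walk-sym treeEdge-sym (to-root _ y∈ refl))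

    -- Parents are unique, so a path without repetitions never goes down and then up.
    starts-up⊎sinks : ∀ {a b} ys → Linked TreeEdge (a ∷ b ∷ ys) → Unique (a ∷ b ∷ ys) →
      parent a ≡ b ⊎ All (λ e → rank a < rank e) (b ∷ ys)
    starts-up⊎sinks _        ((_ , _ , inj₁ ab) ∷ _)  _                     = inj₁ (proj₂ ab)
    starts-up⊎sinks []       ((_ , _ , inj₂ ba) ∷ _)  _                     = inj₂ (child⇒< ba ∷ [])
    starts-up⊎sinks (_ ∷ ys) ((_ , _ , inj₂ ba) ∷ es) ((_ ∷ a≢c ∷ _) ∷ uniq) with starts-up⊎sinks ys es uniq
    ... | inj₁ bc    = contradiction (trans (≡-sym (proj₂ ba)) bc) a≢c
    ... | inj₂ sinks = inj₂ (child⇒< ba ∷ All.map (<-trans (child⇒< ba)) sinks)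

    -- The mirror image, by induction from the far end: if the path from `b` climbs all the way, a
    -- first step down would make `a` the parent of `b`, but that parent already occurs later on the
    -- path.
    ends-down⊎rises : ∀ {a} ys {e} → Linked TreeEdge (a ∷ ys ++ [ e ]) → Unique (a ∷ ys ++ [ e ]) →
      parent e ∈ a ∷ ys ⊎ (parent a ∈ ys ++ [ e ] × rank e < rank a)
    ends-down⊎rises []       ((_ , _ , inj₁ ae) ∷ _) _ = inj₂ (here (proj₂ ae) , child⇒< ae)
    ends-down⊎rises []       ((_ , _ , inj₂ ea) ∷ _) _ = inj₁ (here (proj₂ ea))
    ends-down⊎rises (b ∷ ys) ((_ , _ , c) ∷ es) (a∉ ∷ uniq) with ends-down⊎rises ys es uniq | c
    ... | inj₁ p         | _       = inj₁ (there p)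
    ... | inj₂ (_ , e<b) | inj₁ ab = inj₂ (here (proj₂ ab) , <-trans e<b (child⇒< ab))
    ... | inj₂ (bp , _)  | inj₂ ba = contradiction (proj₂ ba) (All.lookup a∉ (there bp) ∘ ≡-sym)

    -- If the first edge leads down to `y`, the rest of the cycle either starts up, giving `y` a
    -- second parent, or only sinks, and then cannot end at `x`. If it leads up to `y`, the part
    -- from `z` to `x` either contains the parent of `x` a second time or climbs all the way, which
    -- excludes both directions for the edge between `y` and `z`.
    tree-acyclic : ¬ HasCycle TreeEdge
    tree-acyclic (x , [] , _ , () , _)
    tree-acyclic (x , _ ∷ [] , _ , s≤s () , _)
    tree-acyclic (x , y ∷ z ∷ zs , uniq@((_ ∷ x≢z ∷ _) ∷ _) , _ , (_ , _ , c) ∷ es@((_ , _ , c′) ∷ es′)) = go c c′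
      where
      uniq′ : Unique (y ∷ z ∷ zs ++ [ x ])
      uniq′ = Permutation.Unique-resp-↭ (setoid V) (↭⇒↭ₛ (∷↭∷ʳ x (y ∷ z ∷ zs))) uniq

      go : Child x y ⊎ Child y x → Child y z ⊎ Child z y → ⊥
      go (inj₂ yx) _ with starts-up⊎sinks (zs ++ [ x ]) es uniq′
      ... | inj₁ yz    = x≢z (trans (≡-sym (proj₂ yx)) yz)
      ... | inj₂ sinks = <-irrefl refl (<-trans (child⇒< yx) (All.lookup sinks (∈-++⁺ʳ (z ∷ zs) (here refl))))
      go (inj₁ xy) c′ with uniq′
      ... | y∉ ∷ uniq″ with ends-down⊎rises zs es′ uniq″ | c′
      ...   | inj₁ p         | _       = All.lookup y∉ (∈-++⁺ˡ p) (≡-sym (proj₂ xy))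
      ...   | inj₂ (_ , x<z) | inj₁ yz = <-irrefl refl (<-trans (child⇒< xy) (<-trans x<z (child⇒< yz)))
      ...   | inj₂ (zp , _)  | inj₂ zy = All.lookup y∉ (there zp) (≡-sym (proj₂ zy))

  open Tree

  -- Odd minors from pairwise joined trees.

  Joined : Tree → Tree → Set
  Joined S T = (∀ {x} → x ∈ verts S → x ∉ verts T) ×
    ∃[ x ] ∃[ y ] x ∈ verts S × y ∈ verts T × x ~ y × side S x ≡ side T y

  joined-sym : Symmetric Joined
  joined-sym (disj , x , y , x∈ , y∈ , x~y , e) =
    (λ z∈T z∈S → disj z∈S z∈T) , y , x , y∈ , x∈ , ~-sym x~y , ≡-sym e

  -- Each tree is coloured by the parity of its ranks: tree edges change parity, and the edges given
  -- by `Joined` keep it. Disjointness makes `branch` find the only tree that holds a vertex.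
  joined⇒oddKMinor : ∀ {s} (T : Fin s → Tree) → (∀ u v → u ≢ v → Joined (T u) (T v)) → HasOddKMinor G s
  joined⇒oddKMinor {s} T joined = record
    { branch      = branch
    ; tedge       = λ x y → does (edge? x y)
    ; col         = λ x → maybe (λ u → side (T u) x) true (branch x)
    ; tedge-sym   = λ x y → does-⇔ (mk⇔ edge-sym edge-sym) (edge? x y) (edge? y x)
    ; tedge-adj   = λ x y e → treeEdge⇒~ (T _) (proj₂ (witness (edge? x y) e))
    ; nonempty    = λ u → root (T u) , ∈⇒branch (root∈ (T u))
    ; connected   = λ u x y bx by → walk-map
        (λ e@(x∈ , y∈ , _) → ∈⇒branch x∈ , ∈⇒branch y∈ , dec-true (edge? _ _) (u , e))
        (tree-connected (T u) (branch⇒∈ bx) (branch⇒∈ by))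
    ; acyclic     = λ u (x , ys , uniq , long , linked) →
        tree-acyclic (T u) (x , ys , uniq , long , Linked.map within linked)
    ; bichromatic = λ u x y e@(bx , by , _) c → treeEdge⇒side (T u) (within e)
        (trans (≡-sym (colour-at bx)) (trans c (colour-at by)))
    ; realised    = λ u v u≢v → let _ , x , y , x∈ , y∈ , x~y , c = joined u v u≢v in
        x , y , ∈⇒branch x∈ , ∈⇒branch y∈ , x~y ,
        trans (colour-at (∈⇒branch x∈)) (trans c (≡-sym (colour-at (∈⇒branch y∈))))
    }
    where
    witness : ∀ {P : Set} (p? : Dec P) → does p? ≡ true → P
    witness (yes p) _ = p

    branch : V → Maybe (Fin s)
    branch x with Fin.any? (λ u → x ∈? verts (T u))
    ... | yes (u , _) = just u
    ... | no _        = nothing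

    branch⇒∈ : ∀ {x u} → branch x ≡ just u → x ∈ verts (T u)
    branch⇒∈ {x} e with Fin.any? (λ u → x ∈? verts (T u)) | e
    ... | yes (_ , x∈) | refl = x∈

    same : ∀ {x u v} → x ∈ verts (T u) → x ∈ verts (T v) → u ≡ v
    same {u = u} {v} x∈u x∈v = decidable-stable (u Fin.≟ v) λ u≢v → proj₁ (joined u v u≢v) x∈u x∈v

    ∈⇒branch : ∀ {x u} → x ∈ verts (T u) → branch x ≡ just u
    ∈⇒branch {x} {u} x∈ with Fin.any? (λ v → x ∈? verts (T v))
    ... | yes (_ , x∈′) = cong just (same x∈′ x∈)
    ... | no ∉          = contradiction (u , x∈) ∉

    colour-at : ∀ {x u} → branch x ≡ just u → maybe (λ v → side (T v) x) true (branch x) ≡ side (T u) x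
    colour-at {x} e = cong (maybe (λ v → side (T v) x) true) e

    Edge : V → V → Set
    Edge x y = ∃[ u ] TreeEdge (T u) x y

    edge? : ∀ x y → Dec (Edge x y)
    edge? x y = Fin.any? (λ u → treeEdge? (T u) x y)

    edge-sym : ∀ {x y} → Edge x y → Edge y x
    edge-sym (u , e) = u , treeEdge-sym (T u) e

    within : ∀ {u x y} → branch x ≡ just u × branch y ≡ just u × does (edge? x y) ≡ true → TreeEdge (T u) x y
    within {u} {x} {y} (bx , _ , e) with witness (edge? x y) e
    ... | v , xy@(x∈ , _) = subst (λ w → TreeEdge (T w) x y) (same x∈ (branch⇒∈ bx)) xy

  -- Grafting new vertices onto a tree.

  module Graft (T : Tree) (new : List V) (h : ℕ)
    (attached : ∀ {x} → x ∈ new → ∃[ y ] y ∈ verts T × x ~ y × rank T y ≡ h) where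

    grafted-rank : V → ℕ
    grafted-rank x = if does (x ∈? verts T) then rank T x else suc h

    rank-old : ∀ {x} → x ∈ verts T → grafted-rank x ≡ rank T x
    rank-old {x} x∈ = cong (λ b → if b then rank T x else suc h) (dec-true (x ∈? verts T) x∈)

    ∉⇒new : ∀ {x} → x ∈ new ++ verts T → x ∉ verts T → x ∈ new
    ∉⇒new x∈ x∉ = [ (λ x∈new → x∈new) , (λ x∈T → contradiction x∈T x∉) ]′ (∈-++⁻ new x∈)

    -- Used both for a whole breadth-first level and for a single added vertex. Vertices of `T` keep
    -- their ranks, hence their sides.
    graft : Tree
    graft = record
      { verts     = new ++ verts T
      ; root      = root T
      ; root∈     = ∈-++⁺ʳ new (root∈ T)
      ; rank      = grafted-rank
      ; rank-zero = zero-rank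
      ; above     = higher
      }
      where
      zero-rank : ∀ {x} → x ∈ new ++ verts T → grafted-rank x ≡ 0 → x ≡ root T
      zero-rank {x} x∈ e with x ∈? verts T
      ... | yes x∈T = rank-zero T x∈T e

      higher : ∀ {x k} → x ∈ new ++ verts T → grafted-rank x ≡ suc k →
        ∃[ y ] y ∈ new ++ verts T × x ~ y × grafted-rank y ≡ k
      higher {x} x∈ e with x ∈? verts T
      ... | yes x∈T = let y , y∈ , x~y , ry = above T x∈T e in
        y , ∈-++⁺ʳ new y∈ , x~y , trans (rank-old y∈) ry
      ... | no x∉T = let y , y∈ , x~y , ry = attached (∉⇒new x∈ x∉T) in
        y , ∈-++⁺ʳ new y∈ , x~y , trans (rank-old y∈) (trans ry (suc-injective e))

  -- Breadth-first search.

  record Layering (C : List V) : Set where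
    field
      tree      : Tree
      within    : ∀ {x} → x ∈ verts tree → x ∈ C
      depth     : ℕ
      bounded   : ∀ {x} → x ∈ verts tree → rank tree x ≤ depth
      -- Read in both directions, this bounds the change of rank along an edge by one.
      edge-rank : ∀ {x y} → x ∈ verts tree → y ∈ verts tree → x ~ y → rank tree x ≤ suc (rank tree y)
      -- This preserves `edge-rank` when the next level is added: a new vertex has old neighbours
      -- only on the last level.
      frontier  : ∀ {x y} → x ∈ C → x ∉ verts tree → y ∈ verts tree → x ~ y → rank tree y ≡ depth

  open Layering

  -- In this case the tree spans a whole connected component of `C`.
  Exhausted : ∀ {C} → Layering C → Set
  Exhausted {C} L = ∀ {x y} → x ∈ C → y ∈ verts (tree L) → x ~ y → x ∈ verts (tree L)

  singleton-layering : ∀ {C r} → r ∈ C → Layering C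
  singleton-layering {C} {r} r∈ = record
    { tree      = record
      { verts = [ r ] ; root = r ; root∈ = here refl ; rank = λ _ → 0
      ; rank-zero = λ { (here e) _ → e } ; above = λ _ () }
    ; within    = λ { (here refl) → r∈ }
    ; depth     = 0
    ; bounded   = λ _ → z≤n
    ; edge-rank = λ _ _ _ → z≤n
    ; frontier  = λ _ _ _ _ → refl
    }

  module NextLayer {C : List V} (L : Layering C) where
    T : Tree
    T = tree L

    Beyond : V → Set
    Beyond x = x ∉ verts T × Any (x ~_) (verts T)

    beyond? : Decidable Beyond
    beyond? x = ¬? (x ∈? verts T) ×-dec Any.any? (x ~?_) (verts T)

    new : List V
    new = filter beyond? C

    attached : ∀ {x} → x ∈ new → ∃[ y ] y ∈ verts T × x ~ y × rank T y ≡ depth L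
    attached x∈ = let x∈C , x∉T , near = ∈-filter⁻ beyond? x∈
                      y , y∈T , x~y = find near in
      y , y∈T , x~y , frontier L x∈C x∉T y∈T x~y

    open Graft T new (depth L) attached

    within′ : ∀ {x} → x ∈ new ++ verts T → x ∈ C
    within′ x∈ = [ proj₁ ∘ ∈-filter⁻ beyond? , within L ]′ (∈-++⁻ new x∈)

    bounded′ : ∀ {x} → x ∈ new ++ verts T → grafted-rank x ≤ suc (depth L)
    bounded′ {x} x∈ with x ∈? verts T
    ... | yes x∈T = m≤n⇒m≤1+n (bounded L x∈T)
    ... | no _    = ≤-refl

    edge-rank′ : ∀ {x y} → x ∈ new ++ verts T → y ∈ new ++ verts T → x ~ y →
      grafted-rank x ≤ suc (grafted-rank y)
    edge-rank′ {x} {y} x∈ y∈ x~y with x ∈? verts T | y ∈? verts T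
    ... | yes x∈T | yes y∈T = edge-rank L x∈T y∈T x~y
    ... | yes x∈T | no _    = m≤n⇒m≤1+n (m≤n⇒m≤1+n (bounded L x∈T))
    ... | no x∉T  | yes y∈T = s≤s (≤-reflexive (≡-sym (frontier L (within′ x∈) x∉T y∈T x~y)))
    ... | no _    | no _    = m≤n⇒m≤1+n ≤-refl

    -- Every outside neighbour of an old vertex in `C` has just been added, so only the new level
    -- can still meet the rest of `C`.
    frontier′ : ∀ {x y} → x ∈ C → x ∉ new ++ verts T → y ∈ new ++ verts T → x ~ y →
      grafted-rank y ≡ suc (depth L)
    frontier′ {x} {y} x∈ x∉ y∈ x~y with y ∈? verts T
    ... | yes y∈T = contradiction
      (∈-++⁺ˡ (∈-filter⁺ beyond? x∈ (x∉ ∘ ∈-++⁺ʳ new , lose y∈T x~y))) x∉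
    ... | no _    = refl

    grown : Layering C
    grown = record
      { tree = graft ; within = within′ ; depth = suc (depth L) ; bounded = bounded′
      ; edge-rank = edge-rank′ ; frontier = frontier′ }

    next-layer : Exhausted L ⊎ ∃ (Grown (verts ∘ tree) L)
    next-layer with Any.any? beyond? C
    ... | no none = inj₁ λ {x} x∈ y∈ x~y → decidable-stable (x ∈? verts T) λ x∉ →
      none (lose x∈ (x∉ , lose y∈ x~y))
    ... | yes some = let x , x∈ , b = find some in
      inj₂ (grown , ∈-++⁺ʳ new , x , ∈-++⁺ˡ (∈-filter⁺ beyond? x∈ b) , proj₁ b)

  -- The union of tree paths from given vertices to the root.

  module Skeleton (T : Tree) {zs : List V} (zs⊆T : All (_∈ verts T) zs) where

    ancestor : ℕ → V → V
    ancestor zero    z = z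
    ancestor (suc j) z = parent T (ancestor j z)

    ancestor-spec : ∀ {z} j → z ∈ verts T → j ≤ rank T z →
      ancestor j z ∈ verts T × rank T z ≡ j + rank T (ancestor j z)
    ancestor-spec zero z∈ _ = z∈ , refl
    ancestor-spec {z} (suc j) z∈ j<rz =
      let a∈ , rz = ancestor-spec j z∈ (<⇒≤ j<rz)
          k , ra = <⇒∃suc rz j<rz
          p∈ , _ , rp = parent-spec T a∈ ra
      in p∈ , trans rz (trans (cong (j +_) rp) (+-suc j _))

    path : V → List V
    path z = applyUpTo (λ j → ancestor j z) (suc (rank T z))

    -- Including the root keeps the skeleton nonempty even without terminals; it accounts for one
    -- extra vertex in the size bound of a level.
    ends : List V
    ends = root T ∷ zs

    ends⊆T : All (_∈ verts T) ends
    ends⊆T = root∈ T ∷ zs⊆T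

    paths : List V
    paths = concatMap path ends

    ancestor∈paths : ∀ {z j} → z ∈ ends → j ≤ rank T z → ancestor j z ∈ paths
    ancestor∈paths z∈ j≤ = ∈-concatMap⁺ path (lose z∈ (∈-applyUpTo⁺ (λ i → ancestor i _) (s≤s j≤)))

    paths⇒ancestor : ∀ {x} → x ∈ paths → ∃[ z ] ∃[ j ] z ∈ ends × j ≤ rank T z × x ≡ ancestor j z
    paths⇒ancestor x∈ with find (∈-concatMap⁻ path {xs = ends} x∈)
    ... | z , z∈ , x∈path with ∈-applyUpTo⁻ _ x∈path
    ...   | j , s≤s j≤ , e = z , j , z∈ , j≤ , e

    paths⊆T : ∀ {x} → x ∈ paths → x ∈ verts T
    paths⊆T x∈ with paths⇒ancestor x∈
    ... | z , j , z∈ , j≤ , refl = proj₁ (ancestor-spec j (All.lookup ends⊆T z∈) j≤)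

    skeleton : Tree
    skeleton = record
      { verts     = paths
      ; root      = root T
      ; root∈     = ancestor∈paths (here refl) z≤n
      ; rank      = rank T
      ; rank-zero = rank-zero T ∘ paths⊆T
      ; above     = higher
      }
      where
      higher : ∀ {x k} → x ∈ paths → rank T x ≡ suc k → ∃[ y ] y ∈ paths × x ~ y × rank T y ≡ k
      higher {k = k} x∈ rx with paths⇒ancestor x∈
      ... | z , j , z∈ , j≤ , refl =
        let _ , rz = ancestor-spec j (All.lookup ends⊆T z∈) j≤
            _ , x~p , rp = parent-spec T (paths⊆T x∈) rx
            -- The `j`-th ancestor has positive rank, so index `suc j` still lies on the path of
            -- `z`.
            j<rz = ≤-trans (s≤s (m≤m+n j k)) (≤-reflexive (≡-sym (trans rz (trans (cong (j +_) rx) (+-suc j k)))))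
        in parent T (ancestor j z) , ancestor∈paths z∈ j<rz , x~p , suc-injective (trans (≡-sym rp) rx)

    -- One entry per end bounds the size of a level. For an end of rank below `d` the truncated
    -- subtraction returns the end itself, which merely enlarges the list.
    layer : ℕ → List V
    layer d = map (λ z → ancestor (rank T z ∸ d) z) ends

    ∈-layer : ∀ {x} → x ∈ paths → x ∈ layer (rank T x)
    ∈-layer x∈ with paths⇒ancestor x∈
    ... | z , j , z∈ , j≤ , refl =
      let _ , rz = ancestor-spec j (All.lookup ends⊆T z∈) j≤
          rx = rank T (ancestor j z)
          j≡ = trans (cong (_∸ rx) rz) (m+n∸n≡m j rx)
      in subst (_∈ layer rx) (cong (λ i → ancestor i z) j≡) (∈-map⁺ (λ z → ancestor (rank T z ∸ rx) z) z∈)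

  -- Patches: bipartitioned trees with small clusters, and their enlargement.

  TwoSided : Tree → V → Set
  TwoSided T x = ∀ b → ∃[ y ] y ∈ verts T × x ~ y × side T y ≡ b

  -- The lists in `cluster` certify the clustering: constant along monochromatic edges, each
  -- contains the monochromatic component of its vertex.
  record Patch (m : ℕ) (K zs : List V) : Set where
    field
      tree     : Tree
      within   : ∀ {x} → x ∈ verts tree → x ∈ K
      reaches  : ∀ {z} → z ∈ zs → z ∈ verts tree
      cluster  : V → List V
      self     : ∀ {x} → x ∈ verts tree → x ∈ cluster x
      small    : ∀ {x} → x ∈ verts tree → length (cluster x) ≤ m
      together : ∀ {x y} → x ∈ verts tree → y ∈ verts tree → x ~ y → side tree x ≡ side tree y →
        cluster x ≡ cluster y

  module _ {C : List V} (L : Layering C) {zs : List V} (zs⊆L : All (_∈ verts (tree L)) zs) where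
    open Skeleton (tree L) zs⊆L

    -- The clusters are the levels: a monochromatic edge joins vertices of equal breadth-first rank,
    -- and a level has at most one vertex per terminal and one for the root.
    initial-patch : ∀ {m} → length zs < m → Patch m (verts (tree L)) zs
    initial-patch short = record
      { tree     = skeleton
      ; within   = paths⊆T
      ; reaches  = λ z∈ → ancestor∈paths (there z∈) z≤n
      ; cluster  = layer ∘ rank (tree L)
      ; self     = ∈-layer
      ; small    = λ _ → ≤-trans (≤-reflexive (length-map _ ends)) short
      ; together = λ x∈ y∈ x~y e → cong layer (even-close⇒≡
          (edge-rank L (paths⊆T x∈) (paths⊆T y∈) x~y)
          (edge-rank L (paths⊆T y∈) (paths⊆T x∈) (~-sym x~y)) e)
      }

  open Patch

  Maximal : ∀ {m K zs} → Patch m K zs → Set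
  Maximal {K = K} P = ∀ {x y} → x ∈ K → x ∉ verts (tree P) → y ∈ verts (tree P) → x ~ y → TwoSided (tree P) x

  module Enlarge {m : ℕ} (0<m : 0 < m) {K zs : List V} (P : Patch m K zs) where
    T : Tree
    T = tree P

    OneSided : V → V → Set
    OneSided x w = x ~ w × All (λ y → x ~ y → side T y ≡ side T w) (verts T)

    Addable : V → Set
    Addable x = x ∉ verts T × Any (OneSided x) (verts T)

    addable? : Decidable Addable
    addable? x = ¬? (x ∈? verts T) ×-dec Any.any? (λ w →
      (x ~? w) ×-dec All.all? (λ y → (x ~? y) →-dec (side T y Bool.≟ side T w)) (verts T)) (verts T)

    module Add {v w : V} (v∈K : v ∈ K) (v∉T : v ∉ verts T) (w∈T : w ∈ verts T) (one : OneSided v w) where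
      attached : ∀ {x} → x ∈ [ v ] → ∃[ y ] y ∈ verts T × x ~ y × rank T y ≡ rank T w
      attached (here refl) = w , w∈T , proj₁ one , refl

      open Graft T [ v ] (rank T w) attached

      cluster′ : V → List V
      cluster′ x = if does (x ∈? verts T) then cluster P x else [ x ]

      new≡v : ∀ {x} → x ∈ v ∷ verts T → x ∉ verts T → x ≡ v
      new≡v x∈ x∉ with here e ← ∉⇒new x∈ x∉ = e

      -- The new vertex `v` gets the rank after that of `w`, while all its neighbours in `T` share
      -- the side of `w`. Hence `v` can form a cluster alone.
      opposite : ∀ {x y} → x ∈ v ∷ verts T → x ∉ verts T → y ∈ verts T → x ~ y → even (suc (rank T w)) ≢ side T y
      opposite x∈ x∉ y∈ x~y e with new≡v x∈ x∉
      ... | refl = Bool.not-¬ {side T w} refl (trans (≡-sym (All.lookup (proj₂ one) y∈ x~y)) (≡-sym e))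

      together′ : ∀ {x y} → x ∈ v ∷ verts T → y ∈ v ∷ verts T → x ~ y →
        side graft x ≡ side graft y → cluster′ x ≡ cluster′ y
      together′ {x} {y} x∈ y∈ x~y e with x ∈? verts T | y ∈? verts T
      ... | yes x∈T | yes y∈T = together P x∈T y∈T x~y e
      ... | yes x∈T | no y∉T  = contradiction (≡-sym e) (opposite y∈ y∉T x∈T (~-sym x~y))
      ... | no x∉T  | yes y∈T = contradiction e (opposite x∈ x∉T y∈T x~y)
      ... | no x∉T  | no y∉T  = cong [_] (trans (new≡v x∈ x∉T) (≡-sym (new≡v y∈ y∉T)))

      self′ : ∀ {x} → x ∈ v ∷ verts T → x ∈ cluster′ x
      self′ {x} x∈ with x ∈? verts T
      ... | yes x∈T = self P x∈T
      ... | no _    = here refl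

      small′ : ∀ {x} → x ∈ v ∷ verts T → length (cluster′ x) ≤ m
      small′ {x} x∈ with x ∈? verts T
      ... | yes x∈T = small P x∈T
      ... | no _    = 0<m

      grown : Patch m K zs
      grown = record
        { tree     = graft
        ; within   = λ { (here refl) → v∈K ; (there x∈) → within P x∈ }
        ; reaches  = there ∘ reaches P
        ; cluster  = cluster′
        ; self     = self′
        ; small    = small′
        ; together = together′
        }

    -- If `x` sees no vertex on side `b`, all its neighbours in `T` lie on side `not b`, and `y`
    -- witnesses that `x` is addable.
    maximal : ¬ Any Addable K → Maximal P
    maximal none {x} {y} x∈K x∉T y∈T x~y b with Any.any? (λ u → (x ~? u) ×-dec (side T u Bool.≟ b)) (verts T)
    ... | yes found = find found
    ... | no  ¬b    = contradiction
      (lose x∈K (x∉T , lose y∈T (x~y , All.tabulate λ u∈T x~u → trans (off u∈T x~u) (≡-sym (off y∈T x~y))))) none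
      where
      off : ∀ {u} → u ∈ verts T → x ~ u → side T u ≡ not b
      off u∈T x~u = Bool.¬-not (λ e → ¬b (lose u∈T (x~u , e)))

    enlarge : Maximal P ⊎ ∃ (Grown (verts ∘ tree) P)
    enlarge with Any.any? addable? K
    ... | no none = inj₁ (maximal none)
    ... | yes some with find some
    ...   | v , v∈K , v∉T , near with find near
    ...     | w , w∈T , one = inj₂ (Add.grown v∈K v∉T w∈T one , there , v , here refl , v∉T)

  -- The recursive colouring.

  module Recursion (t : ℕ) (noMinor : ¬ HasOddKMinor G t) where

    Piece : Set
    Piece = Tree × Fin t

    JoinedPieces : Piece → Piece → Set
    JoinedPieces (S , _) (T , _) = Joined S T

    -- The invariant between the uncoloured set `C` and an earlier piece; it passes to subsets of
    -- `C`.
    record Borders (C : List V) (Q : Piece) : Set where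
      field
        disjoint  : ∀ {x} → x ∈ C → x ∉ verts (proj₁ Q)
        two-sided : ∀ {x y} → x ∈ C → y ∈ verts (proj₁ Q) → x ~ y → TwoSided (proj₁ Q) x

    open Borders

    borders-⊆ : ∀ {C D Q} → (∀ {x} → x ∈ D → x ∈ C) → Borders C Q → Borders D Q
    borders-⊆ D⊆C border = record { disjoint = disjoint border ∘ D⊆C ; two-sided = two-sided border ∘ D⊆C }

    -- The colour of x is the pair (hue x , shade x); cluster x contains the monochromatic component of x in C.
    record Colouring (C : List V) (Qs : List Piece) : Set where
      field
        hue      : V → Fin t
        shade    : V → Bool
        cluster  : V → List V
        self     : ∀ {x} → x ∈ C → x ∈ cluster x
        small    : ∀ {x} → x ∈ C → length (cluster x) ≤ t
        together : ∀ {x y} → x ∈ C → y ∈ C → x ~ y → hue x ≡ hue y → shade x ≡ shade y → cluster x ≡ cluster y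
        avoids   : ∀ {Q x y} → Q ∈ Qs → x ∈ C → y ∈ verts (proj₁ Q) → x ~ y → hue x ≢ proj₂ Q

    joined⇒length≢ : ∀ {Qs} → AllPairs JoinedPieces Qs → length Qs ≢ t
    joined⇒length≢ {Qs} joined e = noMinor (subst (HasOddKMinor G) e
      (joined⇒oddKMinor (proj₁ ∘ lookup Qs) (allPairs-lookup (λ {S} {T} → joined-sym {proj₁ S} {proj₁ T}) joined)))

    Touches : List V → Piece → Set
    Touches K (T , _) = ∃[ z ] z ∈ K × Any (z ~_) (verts T)

    touches? : ∀ K → Decidable (Touches K)
    touches? K (T , _) = map′ find (λ (_ , z∈ , near) → lose z∈ near)
      (Any.any? (λ z → Any.any? (z ~?_) (verts T)) K)

    -- Only pieces touching `K` are kept in `near`, because the new piece `X` lies in `K` and can be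
    -- joined to no others.
    record Separation (C : List V) (Qs : List Piece) : Set where
      field
        layering  : Layering C
        exhausted : Exhausted layering

      K : List V
      K = verts (tree layering)

      near : List Piece
      near = filter (touches? K) Qs

      field
        {terminals} : List V
        patch       : Patch t K terminals
        maximal     : Maximal patch
        q           : Fin t
        q-fresh     : q ∉ map proj₂ near

      X : Tree
      X = tree patch

      field
        joined : AllPairs JoinedPieces ((X , q) ∷ near)

    separate : ∀ {C Qs r} → r ∈ C → length Qs < t → AllPairs JoinedPieces Qs → All (Borders C) Qs → Separation C Qs
    separate {C} {Qs} r∈C short joined borders
      with L , exhausted ← saturate (verts ∘ tree) NextLayer.next-layer (singleton-layering r∈C)
      -- One terminal in the component for each piece touching it; there are fewer than `t` of
      -- these.
      with zs , |zs|≡ , zs⊆K , touching ← choose (All.all-filter (touches? (verts (tree L))) Qs)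
      with near-short ← ℕ.≤-<-trans (length-filter (touches? (verts (tree L))) Qs) short
      with P , maximal ← saturate (verts ∘ tree) (Enlarge.enlarge (ℕ.≤-<-trans z≤n short))
        (initial-patch L zs⊆K (subst (_< t) (≡-sym |zs|≡) near-short))
      with q , q-fresh ← fresh (map proj₂ (filter (touches? (verts (tree L))) Qs))
        (subst (_< t) (≡-sym (length-map proj₂ (filter (touches? (verts (tree L))) Qs))) near-short)
      = record
        { layering = L ; exhausted = exhausted ; patch = P ; maximal = maximal ; q = q ; q-fresh = q-fresh
        ; joined = All.zipWith {P = Borders C} (join {L} {P = P})
              (All.filter⁺ (touches? (verts (tree L))) borders , touching)
            ∷ AllPairs.filter⁺ (touches? (verts (tree L))) joined
        }
      where
      -- The terminal `z` chosen for `Q` lies in the new tree and sees both sides of `Q`, so one of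
      -- its neighbours there has the side of `z`.
      join : ∀ {L : Layering C} {zs} {P : Patch t (verts (tree L)) zs} {Q} →
        Borders C Q × (∃[ z ] z ∈ zs × Any (z ~_) (verts (proj₁ Q))) → Joined (tree P) (proj₁ Q)
      join {L} {P = P} (border , z , z∈ , touch) =
        let z∈X = reaches P z∈
            X⊆C = λ {x} (x∈ : x ∈ verts (tree P)) → within L (within P x∈)
            _ , y∈ , z~y = find touch
            y′ , y′∈ , z~y′ , e = two-sided border (X⊆C z∈X) y∈ z~y (side (tree P) z)
        in disjoint border ∘ X⊆C , z , y′ , z∈X , y′∈ , z~y′ , ≡-sym e

    module Combine {C : List V} {Qs : List Piece} (S : Separation C Qs)
      (short : length Qs < t) (borders : All (Borders C) Qs) where
      open Separation S

      X⊆C : ∀ {x} → x ∈ verts X → x ∈ C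
      X⊆C = within layering ∘ within patch

      near-short : length near < t
      near-short = ℕ.≤-<-trans (length-filter (touches? K) Qs) short

      short′ : length ((X , q) ∷ near) < t
      -- The new list has at most `t` pieces, and exactly `t` pairwise joined ones would give the
      -- forbidden odd minor.
      short′ = ≤∧≢⇒< near-short (joined⇒length≢ joined)

      inner? : Decidable (λ x → x ∈ K × x ∉ verts X)
      inner? x = (x ∈? K) ×-dec ¬? (x ∈? verts X)

      outer? : Decidable (_∉ K)
      outer? x = ¬? (x ∈? K)

      inner outer : List V
      inner = filter inner? C
      outer = filter outer? C

      -- The root of `X` lies in neither `inner` nor `outer`, so both recursive calls are made on
      -- shorter lists.
      root∈C : root X ∈ C
      root∈C = X⊆C (root∈ X)

      inner-< : length inner < length C
      inner-< = filter-notAll inner? C (lose root∈C λ (_ , ∉X) → ∉X (root∈ X))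

      outer-< : length outer < length C
      outer-< = filter-notAll outer? C (lose root∈C λ ∉K → ∉K (within patch (root∈ X)))

      ∈-inner⁻ : ∀ {x} → x ∈ inner → x ∈ C × x ∈ K × x ∉ verts X
      ∈-inner⁻ = ∈-filter⁻ inner? {xs = C}

      -- For the new piece, two-sidedness is the maximality of the patch; the older pieces hand down
      -- their invariant.
      inner-borders : All (Borders inner) ((X , q) ∷ near)
      inner-borders = record
        { disjoint  = proj₂ ∘ proj₂ ∘ ∈-inner⁻
        ; two-sided = λ x∈ y∈ → let _ , x∈K , x∉X = ∈-inner⁻ x∈ in maximal x∈K x∉X y∈
        } ∷ All.map (borders-⊆ (proj₁ ∘ ∈-inner⁻)) (All.filter⁺ (touches? K) borders)

      outer-borders : All (Borders outer) Qs
      outer-borders = All.map (borders-⊆ (proj₁ ∘ ∈-filter⁻ outer? {xs = C})) borders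

      module Glue (I : Colouring inner ((X , q) ∷ near)) (O : Colouring outer Qs) where
        module I = Colouring I
        module O = Colouring O

        -- Regions carry their evidence, so each property is proved by cases on arbitrary regions
        -- before `region` selects one.
        data Region (x : V) : Set where
          inX   : x ∈ verts X → Region x
          inK∖X : x ∈ K → x ∉ verts X → Region x
          out   : x ∉ K → Region x

        region : ∀ x → Region x
        region x with x ∈? verts X | x ∈? K
        ... | yes x∈X | _       = inX x∈X
        ... | no x∉X  | yes x∈K = inK∖X x∈K x∉X
        ... | no _    | no x∉K  = out x∉K

        select : ∀ {A : Set} {x} → A → A → A → Region x → A
        select a b c (inX _)     = a
        select a b c (inK∖X _ _) = b
        select a b c (out _)     = c

        hue′ : ∀ {x} → Region x → Fin t
        hue′ {x} = select q (I.hue x) (O.hue x)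

        shade′ : ∀ {x} → Region x → Bool
        shade′ {x} = select (side X x) (I.shade x) (O.shade x)

        cluster′ : ∀ {x} → Region x → List V
        cluster′ {x} = select (cluster patch x) (I.cluster x) (O.cluster x)

        ∈-inner : ∀ {x} → x ∈ C → x ∈ K → x ∉ verts X → x ∈ inner
        ∈-inner x∈C x∈K x∉X = ∈-filter⁺ inner? x∈C (x∈K , x∉X)

        ∈-outer : ∀ {x} → x ∈ C → x ∉ K → x ∈ outer
        ∈-outer = ∈-filter⁺ outer?

        self′ : ∀ {x} (ρ : Region x) → x ∈ C → x ∈ cluster′ ρ
        self′ (inX x∈X)       _   = self patch x∈X
        self′ (inK∖X x∈K x∉X) x∈C = I.self (∈-inner x∈C x∈K x∉X)
        self′ (out x∉K)       x∈C = O.self (∈-outer x∈C x∉K)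

        small′ : ∀ {x} (ρ : Region x) → x ∈ C → length (cluster′ ρ) ≤ t
        small′ (inX x∈X)       _   = small patch x∈X
        small′ (inK∖X x∈K x∉X) x∈C = I.small (∈-inner x∈C x∈K x∉X)
        small′ (out x∉K)       x∈C = O.small (∈-outer x∈C x∉K)

        separated : ∀ {x y} → x ∈ C → x ∉ K → y ∈ K → ¬ x ~ y
        separated x∈C x∉K y∈K x~y = x∉K (exhausted x∈C y∈K x~y)

        -- Inside each region the property is inherited. Between `X` and the rest of `K` hues differ
        -- since the inner colouring avoids `q`, and no edge within `C` leaves `K`.
        together′ : ∀ {x y} (ρ : Region x) (σ : Region y) → x ∈ C → y ∈ C → x ~ y →
          hue′ ρ ≡ hue′ σ → shade′ ρ ≡ shade′ σ → cluster′ ρ ≡ cluster′ σ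
        together′ (inX x∈X) (inX y∈X) _ _ x~y _ s = together patch x∈X y∈X x~y s
        together′ (inX x∈X) (inK∖X y∈K y∉X) _ y∈C x~y h _ = contradiction (≡-sym h)
          (I.avoids (here refl) (∈-inner y∈C y∈K y∉X) x∈X (~-sym x~y))
        together′ (inX x∈X) (out y∉K) _ y∈C x~y _ _ =
          contradiction (~-sym x~y) (separated y∈C y∉K (within patch x∈X))
        together′ (inK∖X x∈K x∉X) (inX y∈X) x∈C _ x~y h _ = contradiction h
          (I.avoids (here refl) (∈-inner x∈C x∈K x∉X) y∈X x~y)
        together′ (inK∖X x∈K x∉X) (inK∖X y∈K y∉X) x∈C y∈C =
          I.together (∈-inner x∈C x∈K x∉X) (∈-inner y∈C y∈K y∉X)
        together′ (inK∖X x∈K _) (out y∉K) _ y∈C x~y _ _ =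
          contradiction (~-sym x~y) (separated y∈C y∉K x∈K)
        together′ (out x∉K) (inX y∈X) x∈C _ x~y _ _ = contradiction x~y (separated x∈C x∉K (within patch y∈X))
        together′ (out x∉K) (inK∖X y∈K _) x∈C _ x~y _ _ = contradiction x~y (separated x∈C x∉K y∈K)
        together′ (out x∉K) (out y∉K) x∈C y∈C = O.together (∈-outer x∈C x∉K) (∈-outer y∈C y∉K)

        ∈-near : ∀ {Q x y} → Q ∈ Qs → x ∈ K → y ∈ verts (proj₁ Q) → x ~ y → Q ∈ near
        ∈-near Q∈ x∈K y∈ x~y = ∈-filter⁺ (touches? K) Q∈ (_ , x∈K , lose y∈ x~y)

        -- A piece with a neighbour in `K` belongs to `near`: the fresh `q` differs from its hue,
        -- and the inner colouring avoids it by construction.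
        avoids′ : ∀ {Q x y} (ρ : Region x) → Q ∈ Qs → x ∈ C → y ∈ verts (proj₁ Q) → x ~ y → hue′ ρ ≢ proj₂ Q
        avoids′ (inX x∈X) Q∈ _ y∈ x~y refl =
          q-fresh (∈-map⁺ proj₂ (∈-near Q∈ (within patch x∈X) y∈ x~y))
        avoids′ (inK∖X x∈K x∉X) Q∈ x∈C y∈ x~y =
          I.avoids (there (∈-near Q∈ x∈K y∈ x~y)) (∈-inner x∈C x∈K x∉X) y∈ x~y
        avoids′ (out x∉K) Q∈ x∈C = O.avoids Q∈ (∈-outer x∈C x∉K)

        combined : Colouring C Qs
        combined = record
          { hue      = λ x → hue′ (region x)
          ; shade    = λ x → shade′ (region x)
          ; cluster  = λ x → cluster′ (region x)
          ; self     = self′ (region _)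
          ; small    = small′ (region _)
          ; together = together′ (region _) (region _)
          ; avoids   = avoids′ (region _)
          }

    colouring : ∀ {C Qs} → Acc _<_ (length C) → length Qs < t → AllPairs JoinedPieces Qs →
      All (Borders C) Qs → Colouring C Qs
    colouring {[]} {Qs} _ short _ _ = record
      -- Some hue exists because `short` forces `t` to be positive.
      { hue = λ _ → proj₁ (fresh [] (ℕ.≤-<-trans z≤n short)) ; shade = λ _ → true ; cluster = λ _ → []
      ; self = λ () ; small = λ () ; together = λ () ; avoids = λ _ () }
    colouring {r ∷ C} (acc rec) short joined borders = Glue.combined
      (colouring (rec inner-<) short′ (Separation.joined S) inner-borders)
      (colouring (rec outer-<) short joined outer-borders)
      where
      S : Separation (r ∷ C) _
      S = separate (here refl) short joined borders

      open Combine S short borders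

    -- From hues and shades to the required number of colours.

    clustered : 0 < t → ClusteredColorable G (t * 2) t
    clustered 0<t = colour , bounded-clusters
      where
      -- At the start every vertex is uncoloured and there are no pieces, so all invariants hold
      -- vacuously.
      module F = Colouring (colouring {allFin (n G)} (<-wellFounded _) 0<t [] [])

      shadeIndex : Bool → Fin 2
      shadeIndex true  = Fin.zero
      shadeIndex false = Fin.suc Fin.zero

      shadeIndex-injective : ∀ {a b} → shadeIndex a ≡ shadeIndex b → a ≡ b
      shadeIndex-injective {true}  {true}  _ = refl
      shadeIndex-injective {false} {false} _ = refl

      colour : V → Fin (t * 2)
      colour x = combine (F.hue x) (shadeIndex (F.shade x))

      same-cluster : ∀ {x y} → Walk (MonoEdge G colour) x y → F.cluster x ≡ F.cluster y
      same-cluster here = refl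
      same-cluster (step {x} {y} (x~y , e) walk) =
        let h , s = Fin.combine-injective (F.hue x) _ (F.hue y) _ e in
        trans (F.together (∈-allFin x) (∈-allFin y) x~y h (shadeIndex-injective s)) (same-cluster walk)

      bounded-clusters : HasClustering G colour t
      bounded-clusters v xs uniq walks = ≤-trans
        (unique⊆⇒length≤ uniq (All.map
          (λ {y} walk → subst (y ∈_) (≡-sym (same-cluster walk)) (F.self (∈-allFin y))) walks))
        (F.small (∈-allFin v))

clustered-weaken : ∀ {G k l M} → k ≤ l → ClusteredColorable G k M → ClusteredColorable G l M
clustered-weaken k≤l (α , bounded) = (λ x → inject≤ (α x) k≤l) , λ v xs uniq walks →
  bounded v xs uniq (All.map (walk-map λ (x~y , e) → x~y , Fin.inject≤-injective k≤l k≤l _ _ e) walks)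

t*2≤10*t∸13 : ∀ {t} → 2 ≤ t → t * 2 ≤ 10 * t ∸ 13
t*2≤10*t∸13 {suc (suc s)} (s≤s (s≤s _)) = m+n≤o⇒m≤o∸n ((2 + s) * 2)
  -- With `t = 2 + s`, the slack `8 * t - 13` is `3 + 8 * s`.
  (≤-trans (m≤m+n ((2 + s) * 2 + 13) (3 + 8 * s)) (≤-reflexive (identity s)))
  where
  identity : ∀ s → ((2 + s) * 2 + 13) + (3 + 8 * s) ≡ 10 * (2 + s)
  identity = solve-∀

theorem1p10 : ∀ (t : ℕ) → 2 ≤ t → ∃[ M ] ∀ (G : Graph) →
    ¬ HasOddKMinor G t → ClusteredColorable G (10 * t ∸ 13) M
theorem1p10 t 2≤t = t , λ G noMinor → clustered-weaken {G} (t*2≤10*t∸13 2≤t)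
  (InGraph.Recursion.clustered G t noMinor (<⇒≤ 2≤t))
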